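{- Let $n \geq k \geq l \geq 0$ be integers and let $X$ be a set with $n$ elements. Let $\mathcal{F}$ be a family of $l$-element subsets of $X$ of smallest possible size such that every $k$-element subset of $X$ contains at least one member of $\mathcal{F}$ as a subset, so that $T(n,k,l) = |\mathcal{F}|$. Then $$T(n,k,l) = |\mathcal{F}| \geq \frac{\binom{n}{l}}{\binom{k}{l}}.$$
   Context: For integers $n \geq k \geq l$, the Turán number $T(n,k,l)$ is the smallest number of $l$-element subsets of an $n$-element set $X$ such that every $k$-element subset of $X$ contains at least one of these $l$-element subsets. -}

module Defs where

open import Data.Fin.Subset using (Subset; inside; outside; _⊆_; ∣_∣)
open import Data.Fin.Subset.Properties using (_⊆?_; ⊥⊆; ∣⊥∣≡0; s⊆s; out⊆; anySubset?)
open import Data.List.Base using (List; []; _∷_; length; map; _++_; filter)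
open import Data.List.Membership.Propositional using (_∈_; find; lose)
open import Data.List.Membership.Propositional.Properties using (∈-map⁺; ∈-map⁻; ∈-++⁺ˡ; ∈-++⁺ʳ; ∈-filter⁺)
open import Data.List.Relation.Unary.All using (All; []; all?)
open import Data.List.Relation.Unary.All.Properties using (all-filter)
open import Data.List.Relation.Unary.AllPairs using ([]; _∷_)
open import Data.List.Relation.Unary.Any using (here; any?)
open import Data.List.Relation.Unary.Unique.Propositional using (Unique)
open import Data.List.Relation.Unary.Unique.Propositional.Properties using (map⁺; ++⁺; filter⁺)
import Data.List.Relation.Unary.Unique.DecPropositional as UniqueDec
open import Data.Nat.Base using (ℕ; zero; suc; _≤_; _<_; z≤n; s≤s; NonZero; >-nonZero)
open import Data.Nat.Combinatorics using (_C_; nCk+nC[k+1]≡[n+1]C[k+1])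
open import Data.Nat.Induction using (<-rec)
open import Data.Nat.Properties using (_≟_; ≮⇒≥; anyUpTo?; ≤-trans; m≤m+n; ≤-reflexive; suc-injective)
open import Data.Product.Base using (∃-syntax; _×_; _,_; proj₁; proj₂)
open import Data.Vec.Base using ([]; _∷_)
open import Data.Vec.Properties using (≡-dec; ∷-injectiveʳ)
import Data.Bool.Properties as Bool
open import Relation.Binary.Definitions using (DecidableEquality)
open import Relation.Binary.PropositionalEquality using (_≡_; refl; sym; cong; subst)
open import Relation.Nullary using (¬_; Dec; yes; no)
open import Relation.Nullary.Decidable using (map′; _×-dec_; _→-dec_; ¬?; decidable-stable)

-- A family of subsets of the n-element set Fin n is a duplicate-free list, so
-- that its cardinality is the length of the list.
record IsTuránFamily (n k l : ℕ) (F : List (Subset n)) : Set where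
  field
    unique  : Unique F
    uniform : All (λ B → ∣ B ∣ ≡ l) F
    covers  : (A : Subset n) → ∣ A ∣ ≡ k → ∃[ B ] B ∈ F × B ⊆ A

record IsMinimumTuránFamily (n k l : ℕ) (F : List (Subset n)) : Set where
  field
    isTuránFamily : IsTuránFamily n k l F
    minimum       : (G : List (Subset n)) → IsTuránFamily n k l G → length F ≤ length G

HasTuránFamily : (n k l m : ℕ) → Set
HasTuránFamily n k l m = ∃[ F ] IsTuránFamily n k l F × length F ≡ m

private
  module _ {n : ℕ} where

    _≟ₛ_ : DecidableEquality (Subset n)
    _≟ₛ_ = ≡-dec Bool._≟_

    allSubset? : {P : Subset n → Set} → (∀ A → Dec (P A)) → Dec (∀ A → P A)
    allSubset? P? = map′ (λ ¬∃ A → decidable-stable (P? A) (λ ¬PA → ¬∃ (A , ¬PA)))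
                         (λ all (A , ¬PA) → ¬PA (all A))
                         (¬? (anySubset? (λ A → ¬? (P? A))))

    anyListOfLength? : {P : List (Subset n) → Set} → (∀ F → Dec (P F)) →
                       ∀ m → Dec (∃[ F ] P F × length F ≡ m)
    anyListOfLength? P? zero =
      map′ (λ p → [] , p , refl) (λ { ([] , p , _) → p }) (P? [])
    anyListOfLength? P? (suc m) =
      map′ (λ (A , F , p , eq) → A ∷ F , p , cong suc eq)
           (λ { (A ∷ F , p , eq) → A , F , p , suc-injective eq })
           (anySubset? (λ A → anyListOfLength? (λ F → P? (A ∷ F)) m))

    isTuránFamily? : ∀ k l F → Dec (IsTuránFamily n k l F)
    isTuránFamily? k l F =
      map′ (λ (u , s , c) → record
             { unique = u ; uniform = s ; covers = λ A eq → find (c A eq) })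
           (λ t → let open IsTuránFamily t in
             unique , uniform , λ A eq → let (B , B∈F , B⊆A) = covers A eq in lose {P = _⊆ A} B∈F B⊆A)
           (UniqueDec.unique? _≟ₛ_ F
             ×-dec all? (λ B → ∣ B ∣ ≟ l) F
             ×-dec allSubset? (λ A → (∣ A ∣ ≟ k) →-dec any? (_⊆? A) F))

  subsets : ∀ n → List (Subset n)
  subsets zero    = [] ∷ []
  subsets (suc n) = map (inside ∷_) (subsets n) ++ map (outside ∷_) (subsets n)

  subsets-unique : ∀ n → Unique (subsets n)
  subsets-unique zero    = [] ∷ []
  subsets-unique (suc n) =
    ++⁺ (map⁺ ∷-injectiveʳ (subsets-unique n)) (map⁺ ∷-injectiveʳ (subsets-unique n)) disjoint
    where
    disjoint : ∀ {A} → ¬ (A ∈ map (inside ∷_) (subsets n) × A ∈ map (outside ∷_) (subsets n))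
    disjoint (p , q) with ∈-map⁻ (inside ∷_) p | ∈-map⁻ (outside ∷_) q
    ... | _ , _ , refl | _ , _ , ()

  ∈-subsets : ∀ {n} (A : Subset n) → A ∈ subsets n
  ∈-subsets []            = here refl
  ∈-subsets (inside ∷ A)  = ∈-++⁺ˡ (∈-map⁺ (inside ∷_) (∈-subsets A))
  ∈-subsets (outside ∷ A) = ∈-++⁺ʳ (map (inside ∷_) (subsets _)) (∈-map⁺ (outside ∷_) (∈-subsets A))

  shrink : ∀ {n} l (A : Subset n) → l ≤ ∣ A ∣ → ∃[ B ] ∣ B ∣ ≡ l × B ⊆ A
  shrink {n} zero A _ = _ , ∣⊥∣≡0 n , ⊥⊆
  shrink (suc l) (inside ∷ A) (s≤s l≤) =
    let (B , eq , B⊆A) = shrink l A l≤ in inside ∷ B , cong suc eq , s⊆s B⊆A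
  shrink (suc l) (outside ∷ A) l≤ =
    let (B , eq , B⊆A) = shrink (suc l) A l≤ in outside ∷ B , eq , out⊆ B⊆A

  allOfSize : ∀ {n k} l → l ≤ k →
              IsTuránFamily n k l (filter (λ B → ∣ B ∣ ≟ l) (subsets n))
  allOfSize {n} l l≤k = record
    { unique  = filter⁺ size? (subsets-unique n)
    ; uniform = all-filter size? (subsets n)
    ; covers  = λ A eq →
        let (B , ∣B∣≡l , B⊆A) = shrink l A (subst (l ≤_) (sym eq) l≤k)
        in B , ∈-filter⁺ size? (∈-subsets B) ∣B∣≡l , B⊆A
    }
    where size? = λ (B : Subset n) → ∣ B ∣ ≟ l

  least : {P : ℕ → Set} → (∀ m → Dec (P m)) → ∀ m → P m →
          ∃[ t ] P t × (∀ j → P j → t ≤ j)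
  least {P} P? = <-rec _ step
    where
    step : ∀ m → (∀ {j} → j < m → P j → ∃[ t ] P t × (∀ i → P i → t ≤ i)) →
           P m → ∃[ t ] P t × (∀ i → P i → t ≤ i)
    step m rec Pm with anyUpTo? P? m
    ... | yes (j , j<m , Pj) = rec j<m Pj
    ... | no ¬smaller        = m , Pm , λ i Pi → ≮⇒≥ (λ i<m → ¬smaller (i , i<m , Pi))

leastTurán : ∀ n k l → l ≤ k → ∃[ t ] HasTuránFamily n k l t × (∀ m → HasTuránFamily n k l m → t ≤ m)
leastTurán n k l l≤k =
  least (anyListOfLength? (isTuránFamily? k l)) _ (_ , allOfSize l l≤k , refl)

T : ∀ n k l → k ≤ n → l ≤ k → ℕ
T n k l _ l≤k = proj₁ (leastTurán n k l l≤k)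

C-nonZero : ∀ {k l} → l ≤ k → NonZero (k C l)
C-nonZero l≤k = >-nonZero (positive l≤k)
  where
  positive : ∀ {k l} → l ≤ k → 0 < k C l
  positive z≤n = s≤s z≤n
  positive (s≤s {l} {k} l≤k) =
    ≤-trans (positive l≤k)
      (≤-trans (m≤m+n (k C l) (k C suc l)) (≤-reflexive (nCk+nC[k+1]≡[n+1]C[k+1] k l)))

{-# OPTIONS --safe #-}
module Submission where

-- Count the k-sets A in two ways. Each A contains a member of F, and each member
-- of F lies in exactly (n-l choose k-l) of the A, so
-- (n choose k) ≤ ∣F∣ (n-l choose k-l). Multiply by (k choose l), rewrite the left
-- side with (n choose k)(k choose l) = (n choose l)(n-l choose k-l), and cancel.

open import Defs
open import Data.Fin.Subset using (Subset; inside; outside; ⊥; ∁; _⊆_; ∣_∣)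
open import Data.Fin.Subset.Properties using (⊥⊆; ∣⊥∣≡0; ∣∁p∣≡n∸∣p∣; p⊆q⇒∣p∣≤∣q∣; drop-∷-⊆)
open import Data.Integer.Base using (+_)
import Data.Integer.Base as ℤ
import Data.Integer.Properties as ℤ
open import Data.List.Base using (List; []; _∷_; _++_; concatMap; length; map)
open import Data.List.Membership.Propositional using (_∈_; lose)
open import Data.List.Membership.Propositional.Properties
  using (∈-map⁺; ∈-map⁻; ∈-++⁺ˡ; ∈-++⁺ʳ; ∈-++⁻; ∈-∃++; ∈-concatMap⁺)
open import Data.List.Properties using (length-++; length-++-sucʳ; length-map)
open import Data.List.Relation.Unary.All using (All; []; _∷_)
import Data.List.Relation.Unary.All as All
open import Data.List.Relation.Unary.AllPairs using ([]; _∷_)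
open import Data.List.Relation.Unary.Any using (here; there)
open import Data.List.Relation.Unary.Unique.Propositional using (Unique)
open import Data.List.Relation.Unary.Unique.Propositional.Properties using (map⁺; ++⁺)
open import Data.Nat.Base using (ℕ; zero; suc; _+_; _*_; _∸_; _!; _≤_; z≤n; s≤s; NonZero)
open import Data.Nat.Combinatorics using (_C_; nCk≡n!/k![n-k]!; k![n∸k]!∣n!; nCk+nC[k+1]≡[n+1]C[k+1])
open import Data.Nat.DivMod using (m/n*n≡m)
open import Data.Nat.Properties
open import Data.Nat.Solver using (module +-*-Solver)
open import Data.Product.Base using (_×_; _,_)
open import Data.Rational.Base using (_/_; _≥_)
import Data.Rational.Base as ℚ
import Data.Rational.Properties as ℚ
import Data.Rational.Unnormalised.Base as ℚᵘ
import Data.Rational.Unnormalised.Properties as ℚᵘ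
open import Data.Sum.Base using (inj₁; inj₂)
open import Data.Vec.Base using ([]; _∷_; here)
open import Data.Vec.Properties using (∷-injectiveʳ)
open import Relation.Binary.PropositionalEquality
  using (_≡_; refl; sym; trans; cong; cong₂; subst; subst₂; module ≡-Reasoning)
open import Relation.Nullary using (¬_; contradiction)

-- Induction on `xs`: cut one occurrence of `x` out of `ys`. The tail of `xs` stays inside what is
-- left, because `x` does not recur there. Only `xs` is duplicate-free: in the double count `ys`
-- lists a set once for each member of the family below it.
unique-⊆⇒length-≤ : ∀ {A : Set} {xs ys : List A} → Unique xs →
                    (∀ {x} → x ∈ xs → x ∈ ys) → length xs ≤ length ys
unique-⊆⇒length-≤ [] _ = z≤n
unique-⊆⇒length-≤ {xs = x ∷ xs} (x≢xs ∷ xs!) xs⊆ys with ∈-∃++ (xs⊆ys (here refl))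
... | as , bs , refl = begin
  suc (length xs)         ≤⟨ s≤s (unique-⊆⇒length-≤ xs! xs⊆as++bs) ⟩
  suc (length (as ++ bs)) ≡⟨ length-++-sucʳ as x bs ⟨
  length (as ++ x ∷ bs)   ∎
  where
  open ≤-Reasoning
  xs⊆as++bs : ∀ {y} → y ∈ xs → y ∈ as ++ bs
  xs⊆as++bs y∈xs with ∈-++⁻ as (xs⊆ys (there y∈xs))
  ... | inj₁ y∈as         = ∈-++⁺ˡ y∈as
  ... | inj₂ (here refl)  = contradiction refl (All.lookup x≢xs y∈xs)
  ... | inj₂ (there y∈bs) = ∈-++⁺ʳ as y∈bs

length-concatMap : ∀ {A B : Set} (f : A → List B) {c xs} →
                   All (λ x → length (f x) ≡ c) xs → length (concatMap f xs) ≡ length xs * c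
length-concatMap f [] = refl
length-concatMap f {xs = x ∷ _} (eq ∷ eqs) =
  trans (length-++ (f x)) (cong₂ _+_ eq (length-concatMap f eqs))

-- The supersets of B with exactly j elements outside B.
extensions : ∀ {n} → ℕ → Subset n → List (Subset n)
extensions zero    []            = [] ∷ []
extensions (suc j) []            = []
extensions j       (inside ∷ B)  = map (inside ∷_) (extensions j B)
extensions zero    (outside ∷ B) = map (outside ∷_) (extensions zero B)
extensions (suc j) (outside ∷ B) =
  map (inside ∷_) (extensions j B) ++ map (outside ∷_) (extensions (suc j) B)

-- An extension is a choice of j elements from the complement of `B`. A point outside `B` is either
-- chosen or not, which is Pascal's rule; a point inside `B` leaves no choice.
length-extensions : ∀ {n} j (B : Subset n) → length (extensions j B) ≡ ∣ ∁ B ∣ C j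
length-extensions zero    []            = refl
length-extensions (suc j) []            = refl
length-extensions zero    (inside ∷ B)  =
  trans (length-map _ (extensions zero B)) (length-extensions zero B)
length-extensions (suc j) (inside ∷ B)  =
  trans (length-map _ (extensions (suc j) B)) (length-extensions (suc j) B)
length-extensions zero    (outside ∷ B) =
  trans (length-map _ (extensions zero B)) (length-extensions zero B)
length-extensions (suc j) (outside ∷ B) = begin
  length (map (inside ∷_) (extensions j B) ++ map (outside ∷_) (extensions (suc j) B))
    ≡⟨ length-++ (map (inside ∷_) (extensions j B)) ⟩
  length (map (inside ∷_) (extensions j B)) + length (map (outside ∷_) (extensions (suc j) B))
    ≡⟨ cong₂ _+_ (trans (length-map _ (extensions j B)) (length-extensions j B))
                 (trans (length-map _ (extensions (suc j) B)) (length-extensions (suc j) B)) ⟩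
  ∣ ∁ B ∣ C j + ∣ ∁ B ∣ C suc j
    ≡⟨ nCk+nC[k+1]≡[n+1]C[k+1] ∣ ∁ B ∣ j ⟩
  suc ∣ ∁ B ∣ C suc j ∎
  where open ≡-Reasoning

∈-extensions⁺ : ∀ {n} j {A B : Subset n} → B ⊆ A → ∣ A ∣ ≡ j + ∣ B ∣ → A ∈ extensions j B
∈-extensions⁺ zero    {[]} {[]} B⊆A eq = here refl
∈-extensions⁺ (suc j) {[]} {[]} B⊆A ()
∈-extensions⁺ zero    {inside ∷ A}  {inside ∷ B}  B⊆A eq =
  ∈-map⁺ (inside ∷_) (∈-extensions⁺ zero (drop-∷-⊆ B⊆A) (suc-injective eq))
∈-extensions⁺ (suc j) {inside ∷ A}  {inside ∷ B}  B⊆A eq =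
  ∈-map⁺ (inside ∷_) (∈-extensions⁺ (suc j) (drop-∷-⊆ B⊆A)
    (suc-injective (trans eq (+-suc (suc j) ∣ B ∣))))
-- Here `here` says that the first point lies in `inside ∷ B`; the inclusion would put it in
-- `outside ∷ A`.
∈-extensions⁺ j       {outside ∷ A} {inside ∷ B}  B⊆A eq with () ← B⊆A here
∈-extensions⁺ zero    {inside ∷ A}  {outside ∷ B} B⊆A eq =
  -- No extra element is allowed, yet the first point is one: the sizes give `suc ∣ A ∣ ≡ ∣ B ∣`,
  -- while the tail of the inclusion gives `∣ B ∣ ≤ ∣ A ∣`.
  contradiction (≤-trans (≤-reflexive eq) (p⊆q⇒∣p∣≤∣q∣ (drop-∷-⊆ B⊆A))) 1+n≰n
∈-extensions⁺ zero    {outside ∷ A} {outside ∷ B} B⊆A eq =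
  ∈-map⁺ (outside ∷_) (∈-extensions⁺ zero (drop-∷-⊆ B⊆A) eq)
∈-extensions⁺ (suc j) {inside ∷ A}  {outside ∷ B} B⊆A eq =
  ∈-++⁺ˡ (∈-map⁺ (inside ∷_) (∈-extensions⁺ j (drop-∷-⊆ B⊆A) (suc-injective eq)))
∈-extensions⁺ (suc j) {outside ∷ A} {outside ∷ B} B⊆A eq =
  ∈-++⁺ʳ (map (inside ∷_) (extensions j B))
    (∈-map⁺ (outside ∷_) (∈-extensions⁺ (suc j) (drop-∷-⊆ B⊆A) eq))

∈-extensions⁻ : ∀ {n} j {A} (B : Subset n) → A ∈ extensions j B → ∣ A ∣ ≡ j + ∣ B ∣
∈-extensions⁻ zero    []            (here refl) = refl
∈-extensions⁻ zero    (inside ∷ B)  A∈ with _ , A′∈ , refl ← ∈-map⁻ (inside ∷_) A∈ =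
  cong suc (∈-extensions⁻ zero B A′∈)
∈-extensions⁻ (suc j) (inside ∷ B)  A∈ with _ , A′∈ , refl ← ∈-map⁻ (inside ∷_) A∈ =
  trans (cong suc (∈-extensions⁻ (suc j) B A′∈)) (sym (+-suc (suc j) ∣ B ∣))
∈-extensions⁻ zero    (outside ∷ B) A∈ with _ , A′∈ , refl ← ∈-map⁻ (outside ∷_) A∈ =
  ∈-extensions⁻ zero B A′∈
∈-extensions⁻ (suc j) (outside ∷ B) A∈ with ∈-++⁻ (map (inside ∷_) (extensions j B)) A∈
... | inj₁ A∈ˡ with _ , A′∈ , refl ← ∈-map⁻ (inside ∷_) A∈ˡ =
  cong suc (∈-extensions⁻ j B A′∈)
... | inj₂ A∈ʳ with _ , A′∈ , refl ← ∈-map⁻ (outside ∷_) A∈ʳ =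
  ∈-extensions⁻ (suc j) B A′∈

extensions-unique : ∀ {n} j (B : Subset n) → Unique (extensions j B)
extensions-unique zero    []            = [] ∷ []
extensions-unique (suc j) []            = []
extensions-unique zero    (inside ∷ B)  = map⁺ ∷-injectiveʳ (extensions-unique zero B)
extensions-unique (suc j) (inside ∷ B)  = map⁺ ∷-injectiveʳ (extensions-unique (suc j) B)
extensions-unique zero    (outside ∷ B) = map⁺ ∷-injectiveʳ (extensions-unique zero B)
extensions-unique (suc j) (outside ∷ B) =
  ++⁺ (map⁺ ∷-injectiveʳ (extensions-unique j B))
      (map⁺ ∷-injectiveʳ (extensions-unique (suc j) B))
      disjoint
  where
  disjoint : ∀ {A} → ¬ (A ∈ map (inside ∷_) (extensions j B) ×
                        A ∈ map (outside ∷_) (extensions (suc j) B))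
  disjoint (p , q) with ∈-map⁻ (inside ∷_) p | ∈-map⁻ (outside ∷_) q
  ... | _ , _ , refl | _ , _ , ()

-- Writing k as j + l makes the k-sets above an l-set `B` exactly `extensions j B`, with no
-- truncated subtraction in the sizes.
nCk≤length*[n∸l]Cj : ∀ {n l} j {F} → IsTuránFamily n (j + l) l F →
                     n C (j + l) ≤ length F * ((n ∸ l) C j)
nCk≤length*[n∸l]Cj {n} {l} j {F} turán = begin
  -- The complement of `⊥` is the whole ground set, so `extensions k ⊥` enumerates all k-sets.
  n C k                                ≡⟨ cong (_C k) ∣∁⊥∣≡n ⟨
  ∣ ∁ (⊥ {n}) ∣ C k                    ≡⟨ length-extensions k ⊥ ⟨
  length (extensions k (⊥ {n}))        ≤⟨ unique-⊆⇒length-≤ (extensions-unique k ⊥) covered ⟩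
  length (concatMap (extensions j) F)  ≡⟨ length-concatMap (extensions j) (All.map degree uniform) ⟩
  length F * ((n ∸ l) C j)             ∎
  where
  open ≤-Reasoning
  open IsTuránFamily turán

  k = j + l

  ∣∁⊥∣≡n : ∣ ∁ (⊥ {n}) ∣ ≡ n
  ∣∁⊥∣≡n = trans (∣∁p∣≡n∸∣p∣ (⊥ {n})) (cong (n ∸_) (∣⊥∣≡0 n))

  degree : ∀ {B : Subset n} → ∣ B ∣ ≡ l → length (extensions j B) ≡ (n ∸ l) C j
  degree {B} refl = trans (length-extensions j B) (cong (_C j) (∣∁p∣≡n∸∣p∣ B))

  covered : ∀ {A} → A ∈ extensions k ⊥ → A ∈ concatMap (extensions j) F
  covered {A} A∈ =
    let ∣A∣≡k = trans (∈-extensions⁻ k ⊥ A∈) (trans (cong (λ i → k + i) (∣⊥∣≡0 n)) (+-identityʳ k))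
        B , B∈F , B⊆A = covers A ∣A∣≡k
        ∣A∣≡j+∣B∣ = trans ∣A∣≡k (cong (λ i → j + i) (sym (All.lookup uniform B∈F)))
    in ∈-concatMap⁺ (extensions j) (lose B∈F (∈-extensions⁺ j B⊆A ∣A∣≡j+∣B∣))

-- The factorial formula with its division cleared, which is legitimate since k! (n-k)! divides n!.
nCk*k![n∸k]!≡n! : ∀ {n k} → k ≤ n → (n C k) * (k ! * (n ∸ k) !) ≡ n !
nCk*k![n∸k]!≡n! {n} {k} k≤n =
  trans (cong (_* (k ! * (n ∸ k) !)) (nCk≡n!/k![n-k]! k≤n)) (m/n*n≡m (k![n∸k]!∣n! k≤n))
  where instance _ = k !* (n ∸ k) !≢0

-- Both sides count the pairs of an l-set inside a k-set. The proof is by factorials: each side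
-- times l! (k-l)! (n-k)! equals n!.
nCk*kCl≡nCl*[n∸l]C[k∸l] : ∀ {n k l} → l ≤ k → k ≤ n →
                          (n C k) * (k C l) ≡ (n C l) * ((n ∸ l) C (k ∸ l))
nCk*kCl≡nCl*[n∸l]C[k∸l] {n} {k} {l} l≤k k≤n = *-cancelʳ-≡ _ _ (l ! * (x ! * y !)) (begin
  (n C k) * (k C l) * (l ! * (x ! * y !))
    ≡⟨ solve 5 (λ p q a b c → p :* q :* (a :* (b :* c)) := p :* (q :* (a :* b) :* c)) refl
         (n C k) (k C l) (l !) (x !) (y !) ⟩
  (n C k) * ((k C l) * (l ! * x !) * y !)
    ≡⟨ cong (λ z → (n C k) * (z * y !)) (nCk*k![n∸k]!≡n! l≤k) ⟩
  (n C k) * (k ! * y !)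
    ≡⟨ nCk*k![n∸k]!≡n! k≤n ⟩
  n !
    ≡⟨ nCk*k![n∸k]!≡n! (≤-trans l≤k k≤n) ⟨
  (n C l) * (l ! * (n ∸ l) !)
    ≡⟨ cong (λ z → (n C l) * (l ! * z)) (nCk*k![n∸k]!≡n! (∸-monoˡ-≤ l k≤n)) ⟨
  (n C l) * (l ! * (((n ∸ l) C x) * (x ! * ((n ∸ l) ∸ x) !)))
    ≡⟨ cong (λ z → (n C l) * (l ! * (((n ∸ l) C x) * (x ! * z !)))) n∸l∸x≡y ⟩
  (n C l) * (l ! * (((n ∸ l) C x) * (x ! * y !)))
    ≡⟨ solve 5 (λ p q a b c → p :* (a :* (q :* (b :* c))) := p :* q :* (a :* (b :* c))) refl
         (n C l) ((n ∸ l) C x) (l !) (x !) (y !) ⟩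
  (n C l) * ((n ∸ l) C x) * (l ! * (x ! * y !)) ∎)
  where
  open ≡-Reasoning
  open +-*-Solver
  x = k ∸ l
  y = n ∸ k

  n∸l∸x≡y : (n ∸ l) ∸ x ≡ y
  n∸l∸x≡y = trans (∸-+-assoc n l x) (cong (n ∸_) (m+[n∸m]≡n l≤k))

  instance
    x!*y!≢0 = x !* y !≢0
    l!*x!*y!≢0 = m*n≢0 (l !) (x ! * y !) {{l !≢0}}

nCl≤length*kCl : ∀ {n k l F} → l ≤ k → k ≤ n → IsTuránFamily n k l F →
                 n C l ≤ length F * (k C l)
nCl≤length*kCl {n} {k} {l} {F} l≤k k≤n turán = *-cancelʳ-≤ _ _ ((n ∸ l) C (k ∸ l)) (begin
  (n C l) * ((n ∸ l) C (k ∸ l))              ≡⟨ nCk*kCl≡nCl*[n∸l]C[k∸l] l≤k k≤n ⟨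
  (n C k) * (k C l)                          ≤⟨ *-monoˡ-≤ (k C l) nCk≤ ⟩
  length F * ((n ∸ l) C (k ∸ l)) * (k C l)
    ≡⟨ solve 3 (λ a b c → a :* b :* c := a :* c :* b) refl
         (length F) ((n ∸ l) C (k ∸ l)) (k C l) ⟩
  length F * (k C l) * ((n ∸ l) C (k ∸ l))   ∎)
  where
  open ≤-Reasoning
  open +-*-Solver
  -- The common factor may be cancelled because k-l ≤ n-l makes it positive.
  instance _ = C-nonZero (∸-monoˡ-≤ l k≤n)

  k∸l+l≡k : k ∸ l + l ≡ k
  k∸l+l≡k = m∸n+n≡m l≤k

  nCk≤ : n C k ≤ length F * ((n ∸ l) C (k ∸ l))
  nCk≤ = subst (λ i → n C i ≤ length F * ((n ∸ l) C (k ∸ l))) k∸l+l≡k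
    (nCk≤length*[n∸l]Cj (k ∸ l) (subst (λ i → IsTuránFamily n i l F) (sym k∸l+l≡k) turán))

-- `_/_` reduces to lowest terms, which hides the given numerators and denominators. Among
-- unnormalised rationals the order is cross-multiplication by definition, so the comparison is
-- carried out there.
*≤*⇒/≤/ : ∀ a b c d .{{_ : NonZero c}} .{{_ : NonZero d}} →
          a * d ≤ b * c → (+ a) / c ℚ.≤ (+ b) / d
*≤*⇒/≤/ a b (suc c) (suc d) ad≤bc = ℚ.toℚᵘ-cancel-≤
  -- `mkℚᵘ` stores the denominator minus one, so `mkℚᵘ (+ a) c` is the unreduced form of
  -- `(+ a) / suc c`.
  (ℚᵘ.≤-respˡ-≃ (ℚᵘ.≃-sym (ℚ.toℚᵘ-fromℚᵘ (ℚᵘ.mkℚᵘ (+ a) c)))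
    (ℚᵘ.≤-respʳ-≃ (ℚᵘ.≃-sym (ℚ.toℚᵘ-fromℚᵘ (ℚᵘ.mkℚᵘ (+ b) d)))
      (ℚᵘ.*≤* (subst₂ ℤ._≤_ (ℤ.pos-* a (suc d)) (ℤ.pos-* b (suc c)) (ℤ.+≤+ ad≤bc)))))

-- The least value is attained by some family `G`. Leastness bounds it by the length of `F`, and
-- minimality of `F` gives the converse bound.
T≡length : ∀ {n k l F} (k≤n : k ≤ n) (l≤k : l ≤ k) →
           IsMinimumTuránFamily n k l F → T n k l k≤n l≤k ≡ length F
T≡length {n} {k} {l} {F} k≤n l≤k min with leastTurán n k l l≤k
... | _ , (G , G-turán , refl) , least =
  ≤-antisym (least (length F) (F , isTuránFamily , refl)) (minimum G G-turán)
  where open IsMinimumTuránFamily min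

theorem2p2 : (n k l : ℕ) (k≤n : k ≤ n) (l≤k : l ≤ k)
    (F : List (Subset n)) → IsMinimumTuránFamily n k l F →
    (T n k l k≤n l≤k ≡ length F) ×
    ((+ length F) / 1 ≥ ((+ (n C l)) / (k C l)) {{C-nonZero l≤k}})
theorem2p2 n k l k≤n l≤k F min =
  T≡length k≤n l≤k min ,
  *≤*⇒/≤/ (n C l) (length F) (k C l) 1 {{C-nonZero l≤k}}
    -- The factor 1 removed here is the denominator of `(+ length F) / 1` after
    -- cross-multiplication.
    (subst (_≤ length F * (k C l)) (sym (*-identityʳ (n C l)))
      (nCl≤length*kCl l≤k k≤n (IsMinimumTuránFamily.isTuránFamily min)))
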